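{- Let $w_1,w_2,w_3$ be any odd positive integers and let $n\ge 0$ be an integer. Then \begin{align*} &\sum_{k+l+m=n}\binom{n}{k,l,m}T_{k,q^{w_3}}(w_1-1)T_{l,q^{w_1}}(w_2-1)T_{m,q^{w_2}}(w_3-1)\,w_3^{k}w_1^{l}w_2^{m}\\ =&\sum_{k+l+m=n}\binom{n}{k,l,m}T_{k,q^{w_2}}(w_1-1)T_{l,q^{w_1}}(w_3-1)T_{m,q^{w_3}}(w_2-1)\,w_2^{k}w_1^{l}w_3^{m}. \end{align*}
   Context: Let $p$ be a fixed odd prime, $\mathbb{C}_p$ the completion of an algebraic closure of $\mathbb{Q}_p$ with absolute value normalized by $|p|_p=1/p$, and let $q\in\mathbb{C}_p$ be fixed with $|q-1|_p<p^{ -1/(p-1)}$. For $r=q^w$ ($w$ a positive integer) and integers $k,N\ge 0$, the $r$-analogue of the alternating power sum is $T_{k,r}(N)=\sum_{i=0}^{N}(-1)^i i^k r^i$, with the convention $0^0=1$. Sums over $k+l+m=n$ run over all nonnegative integers $k,l,m$ with $k+l+m=n$, and $\binom{n}{k,l,m}=\frac{n!}{k!\,l!\,m!}$. -}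

module Defs where

open import Level using (Level; suc) renaming (_⊔_ to _⊔ℓ_)
open import Data.Nat.Base as ℕ using (ℕ; NonZero; _∸_; _!)
open import Data.Nat.Divisibility using (_∤_)
open import Data.Nat.Primality using (Prime; prime⇒nonTrivial)
import Data.Nat.Properties as ℕₚ
import Data.Nat.DivMod as ℕ÷
open import Data.Integer.Base using (+_)
open import Data.Rational.Base as ℚ using (ℚ)
open import Data.Fin.Base using (Fin; toℕ)
open import Data.Product.Base using (Σ-syntax; ∃-syntax)
open import Function.Bundles using (_⇔_)
open import Relation.Binary.PropositionalEquality using (_≡_)
open import Algebra.Bundles using (CommutativeRing; Ring; Semiring)
open import Algebra.Apartness.Bundles using (HeytingField; HeytingCommutativeRing)
open import Algebra.Morphism.Structures using (module RingMorphisms)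
import Algebra.Definitions.RawSemiring as RawSemiringDefinitions

Odd : ℕ → Set
Odd n = 2 ∤ n

-- The set {0} ∪ { p^a | a ∈ ℚ } of real numbers, for a fixed p > 1. It
-- contains every value of the absolute value of ℂₚ, whose value group is
-- exactly p^ℚ. Its order and product do not depend on p.
data Magnitude : Set where
  𝟎   : Magnitude
  p^_ : ℚ → Magnitude

infix 9 p^_
infixl 7 _*ᵐ_
infixl 6 _⊔ᵐ_
infix 4 _<ᵐ_ _≤ᵐ_

data _<ᵐ_ : Magnitude → Magnitude → Set where
  𝟎<p^  : ∀ {a} → 𝟎 <ᵐ p^ a
  p^<p^ : ∀ {a b} → a ℚ.< b → p^ a <ᵐ p^ b

data _≤ᵐ_ : Magnitude → Magnitude → Set where
  𝟎≤    : ∀ {x} → 𝟎 ≤ᵐ x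
  p^≤p^ : ∀ {a b} → a ℚ.≤ b → p^ a ≤ᵐ p^ b

_*ᵐ_ : Magnitude → Magnitude → Magnitude
𝟎    *ᵐ y    = 𝟎
p^ a *ᵐ 𝟎    = 𝟎
p^ a *ᵐ p^ b = p^ (a ℚ.+ b)

_⊔ᵐ_ : Magnitude → Magnitude → Magnitude
𝟎    ⊔ᵐ y    = y
p^ a ⊔ᵐ 𝟎    = p^ a
p^ a ⊔ᵐ p^ b = p^ (a ℚ.⊔ b)

record ValuedField c ℓ₁ ℓ₂ : Set (suc (c ⊔ℓ ℓ₁ ⊔ℓ ℓ₂)) where
  field
    heytingField : HeytingField c ℓ₁ ℓ₂

  commutativeRing : CommutativeRing c ℓ₁
  commutativeRing = HeytingCommutativeRing.commutativeRing
                      (HeytingField.heytingCommutativeRing heytingField)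

  open CommutativeRing commutativeRing public

  field
    ∣_∣        : Carrier → Magnitude
    ∣∣-cong    : ∀ {x y} → x ≈ y → ∣ x ∣ ≡ ∣ y ∣
    ∣x∣≡𝟎⇔x≈0  : ∀ {x} → (∣ x ∣ ≡ 𝟎) ⇔ (x ≈ 0#)
    ∣x*y∣      : ∀ x y → ∣ x * y ∣ ≡ ∣ x ∣ *ᵐ ∣ y ∣
    ∣x+y∣      : ∀ x y → ∣ x + y ∣ ≤ᵐ ∣ x ∣ ⊔ᵐ ∣ y ∣

module _ {c ℓ₁ ℓ₂ : Level} (K : ValuedField c ℓ₁ ℓ₂) where
  open ValuedField K
  open RawSemiringDefinitions (Semiring.rawSemiring semiring) using (sum; _^_)

  Cauchy : (ℕ → Carrier) → Set
  Cauchy s = ∀ (a : ℚ) → ∃[ N ] (∀ i j → N ℕ.≤ i → N ℕ.≤ j → ∣ s i - s j ∣ <ᵐ p^ a)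

  ConvergesTo : (ℕ → Carrier) → Carrier → Set
  ConvergesTo s x = ∀ (a : ℚ) → ∃[ N ] (∀ i → N ℕ.≤ i → ∣ s i - x ∣ <ᵐ p^ a)

  Complete : Set c
  Complete = ∀ s → Cauchy s → ∃[ x ] ConvergesTo s x

  Dense : ∀ {a} {A : Set a} → (A → Carrier) → Set (a ⊔ℓ c)
  Dense f = ∀ y (a : ℚ) → ∃[ x ] (∣ y - f x ∣ <ᵐ p^ a)

  -- x^d + ∑_{i<d} aᵢ x^i
  evalMonic : ∀ {d} → (Fin d → Carrier) → Carrier → Carrier
  evalMonic {d} a x = x ^ d + sum {d} (λ i → a i * x ^ toℕ i)

  AlgebraicallyClosed : Set (c ⊔ℓ ℓ₁)
  AlgebraicallyClosed =
    ∀ d (a : Fin (ℕ.suc d) → Carrier) → ∃[ x ] (evalMonic a x ≈ 0#)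

record Extension {c ℓ₁ ℓ₂} (K L : ValuedField c ℓ₁ ℓ₂) : Set (c ⊔ℓ ℓ₁) where
  private
    module K = ValuedField K
    module L = ValuedField L
  open RingMorphisms (Ring.rawRing K.ring) (Ring.rawRing L.ring) using (IsRingHomomorphism)
  field
    ι                  : K.Carrier → L.Carrier
    isRingHomomorphism : IsRingHomomorphism ι
    ∣ι∣                : ∀ x → L.∣ ι x ∣ ≡ K.∣ x ∣

  Algebraic : Set (c ⊔ℓ ℓ₁)
  Algebraic = ∀ y → ∃[ d ] Σ[ a ∈ (Fin d → K.Carrier) ]
                evalMonic L (λ i → ι (a i)) y L.≈ L.0#

-- ℂₚ, up to isometric isomorphism, as the last term of a tower ℚ → ℚₚ → ℚ̄ₚ → ℂₚ:
-- a completion, an algebraic closure, a completion.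
record PadicComplexNumbers (p : ℕ) c ℓ₁ ℓ₂ : Set (suc (c ⊔ℓ ℓ₁ ⊔ℓ ℓ₂)) where
  field
    ℚₚ : ValuedField c ℓ₁ ℓ₂

  open RingMorphisms ℚ.+-*-rawRing (Ring.rawRing (ValuedField.ring ℚₚ)) using (IsRingHomomorphism)

  -- For p prime, an ultrametric absolute value on ℚ with |p| = p⁻¹ is the
  -- p-adic one: a Bézout relation forces |n| = 1 for every n prime to p.
  field
    fromℚ                    : ℚ → ValuedField.Carrier ℚₚ
    fromℚ-isRingHomomorphism : IsRingHomomorphism fromℚ
    ∣p∣                      : ValuedField.∣_∣ ℚₚ (fromℚ (+ p ℚ./ 1)) ≡ p^ (ℚ.- ℚ.1ℚ)
    ℚ-dense                  : Dense ℚₚ fromℚ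
    ℚₚ-complete              : Complete ℚₚ

  field
    ℚ̄ₚ                     : ValuedField c ℓ₁ ℓ₂
    ℚ̄ₚ/ℚₚ                  : Extension ℚₚ ℚ̄ₚ
    ℚ̄ₚ-algebraic           : Extension.Algebraic ℚ̄ₚ/ℚₚ
    ℚ̄ₚ-algebraicallyClosed : AlgebraicallyClosed ℚ̄ₚ

  field
    ℂₚ          : ValuedField c ℓ₁ ℓ₂
    ℂₚ/ℚ̄ₚ       : Extension ℚ̄ₚ ℂₚ
    ℚ̄ₚ-dense    : Dense ℂₚ (Extension.ι ℂₚ/ℚ̄ₚ)
    ℂₚ-complete : Complete ℂₚ

convergenceRadius : ∀ {p} → Prime p → Magnitude
convergenceRadius {p} pr = p^ (ℚ.- (+ 1 ℚ./ (p ∸ 1)))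
  where instance
    p∸1≢0 : NonZero (p ∸ 1)
    p∸1≢0 = ℕ.>-nonZero (ℕₚ.m<n⇒0<n∸m (ℕ.nonTrivial⇒n>1 p {{prime⇒nonTrivial pr}}))

multinomial : (n k l m : ℕ) → ℕ
multinomial n k l m = (n !) ℕ÷./ (k ! ℕ.* l ! ℕ.* m !)
  where instance
    k!l!m!≢0 : NonZero (k ! ℕ.* l ! ℕ.* m !)
    k!l!m!≢0 = ℕₚ.m*n≢0 (k ! ℕ.* l !) (m !) {{ℕₚ._!*_!≢0 k l}} {{ℕₚ._!≢0 m}}

module PowerSums {c ℓ₁ ℓ₂ : Level} (K : ValuedField c ℓ₁ ℓ₂) where
  open ValuedField K
  open RawSemiringDefinitions (Semiring.rawSemiring semiring) public using (sum; _^_)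
  open RawSemiringDefinitions (Semiring.rawSemiring semiring) using () renaming (_×_ to _·_)

  fromℕ : ℕ → Carrier
  fromℕ n = n · 1#

  -- T k r N is T_{k,r}(N); x ^ 0 is 1# for every x, so 0^0 = 1.
  T : ℕ → Carrier → ℕ → Carrier
  T k r N = sum {ℕ.suc N} (λ i → (- 1#) ^ toℕ i * fromℕ (toℕ i) ^ k * r ^ toℕ i)

  -- The sum of f k l m over k + l + m = n: k ranges over 0..n and l over
  -- 0..n-k, which leaves m = n - k - l.
  sum₃ : (n : ℕ) → (ℕ → ℕ → ℕ → Carrier) → Carrier
  sum₃ n f =
    sum {ℕ.suc n} (λ k →
      sum {ℕ.suc (n ∸ toℕ k)} (λ l →
        f (toℕ k) (toℕ l) (n ∸ toℕ k ∸ toℕ l)))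

{-# OPTIONS --safe #-}

-- Let [N](y) = ∑_{i<N} (-y)^i. By the trinomial theorem the two sides are the
-- values, under the linear functional x^a ↦ a^n q^a, of the polynomials
--   [w₁](x^w₃) [w₂](x^w₁) [w₃](x^w₂)   and   [w₁](x^w₂) [w₃](x^w₁) [w₂](x^w₃).
-- For N odd, (1 + y) [N](y) = 1 + y^N, so multiplication by
-- (1 + x^w₁)(1 + x^w₂)(1 + x^w₃) turns both products into
-- (1 + x^(w₁w₂))(1 + x^(w₁w₃))(1 + x^(w₂w₃)). As 1 + x^w is not a zero divisor
-- among power series for w > 0, the two polynomials are equal.
module Submission where

open import Defs
open import Level using (Level)
open import Data.Nat.Base using (ℕ; _∸_)
open import Data.Nat.Primality using (Prime)

open import Algebra.Bundles using (CommutativeRing)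
open import Data.Empty using (⊥-elim)
open import Data.Fin.Base using (Fin; zero; suc; toℕ)
open import Data.Fin.Properties using (toℕ≤pred[n]; toℕ≤n)
open import Data.Nat.Base as ℕ using (zero; suc; s≤s; _!)
open import Data.Nat.Combinatorics using (_C_; nCk≡n!/k![n-k]!; k![n∸k]!∣n!)
open import Data.Nat.Divisibility using (m%n≡0⇒n∣m)
open import Data.Nat.DivMod using (m*n/n≡m; m/n*n≡m; m≡m%n+[m/n]*n; m%n<n; _/_; _%_)
open import Data.Nat.Induction using (<-rec)
open import Data.Nat.Solver using (module +-*-Solver)
open import Data.Product.Base using (∃-syntax; _,_)
open import Relation.Binary.PropositionalEquality as ≡ using (_≡_)
import Algebra.Properties.CommutativeSemiring.Binomial as Binomial
import Algebra.Properties.CommutativeSemiring.Exp as Exp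
import Algebra.Properties.Ring as RingProperties
import Algebra.Properties.Semiring.Mult as Mult
import Algebra.Properties.Semiring.Sum as Sum
import Algebra.Solver.Ring.NaturalCoefficients.Default as SemiringSolver
import Data.Nat.Properties as ℕₚ
import Relation.Binary.Reasoning.Setoid as SetoidReasoning

-- Odd numbers and trinomial coefficients.

-- Matching on this equation makes `w ∸ 1` compute to `k * 2` and puts w in the successor form that
-- `1+x^-cancel` requires.
odd⇒1+2k : ∀ {n} → Odd n → ∃[ k ] n ≡ suc (k ℕ.* 2)
odd⇒1+2k {n} 2∤n with n % 2 in eq | m≡m%n+[m/n]*n n 2 | m%n<n n 2
... | 0           | _   | _                = ⊥-elim (2∤n (m%n≡0⇒n∣m n 2 eq))
... | 1           | n≡  | _                = n / 2 , n≡
... | suc (suc _) | _   | s≤s (s≤s ())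

nCk*k!*[n∸k]!≡n! : ∀ {n k} → k ℕ.≤ n → (n C k) ℕ.* (k ! ℕ.* (n ∸ k) !) ≡ n !
nCk*k!*[n∸k]!≡n! {n} {k} k≤n = ≡.trans
  (≡.cong (ℕ._* (k ! ℕ.* (n ∸ k) !)) (nCk≡n!/k![n-k]! k≤n))
  (m/n*n≡m {{ℕₚ._!*_!≢0 k (n ∸ k)}} (k![n∸k]!∣n! k≤n))

-- Splitting n! by the first binomial coefficient, and then (n-k)! by the second, leaves exactly k!
-- l! m! as the other factor, so the division in `multinomial` is exact. This is the form in which
-- two nested binomial theorems produce the coefficient.
multinomial≡C*C : ∀ {n k l} → k ℕ.≤ n → l ℕ.≤ n ∸ k →
  multinomial n k l (n ∸ k ∸ l) ≡ (n C k) ℕ.* ((n ∸ k) C l)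
multinomial≡C*C {n} {k} {l} k≤n l≤n∸k = ≡.trans
  (≡.cong (λ x → (x / (k ! ℕ.* l ! ℕ.* m !)) {{k!l!m!≢0}}) n!≡)
  (m*n/n≡m ((n C k) ℕ.* ((n ∸ k) C l)) (k ! ℕ.* l ! ℕ.* m !) {{k!l!m!≢0}})
  where
  open +-*-Solver
  m = n ∸ k ∸ l
  k!l!m!≢0 = ℕₚ.m*n≢0 (k ! ℕ.* l !) (m !) {{ℕₚ._!*_!≢0 k l}} {{ℕₚ._!≢0 m}}
  n!≡ : n ! ≡ (n C k) ℕ.* ((n ∸ k) C l) ℕ.* (k ! ℕ.* l ! ℕ.* m !)
  n!≡ = ≡.trans (≡.sym (nCk*k!*[n∸k]!≡n! k≤n))
    (≡.trans (≡.cong (λ x → (n C k) ℕ.* (k ! ℕ.* x)) (≡.sym (nCk*k!*[n∸k]!≡n! l≤n∸k)))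
      (solve 5 (λ c d x y z → c :* (x :* (d :* (y :* z))) := c :* d :* (x :* y :* z))
        ≡.refl (n C k) ((n ∸ k) C l) (k !) (l !) (m !)))

-- Formal power series and multiplication by x^w.

-- A power series ∑ f(a) x^a is represented by its coefficient function f.
module PowerSeries {c ℓ} (R : CommutativeRing c ℓ) where
  open CommutativeRing R
  open Sum semiring
  open Exp commutativeSemiring using (_^_)
  open RingProperties ring using (-1*x≈-x; -‿involutive; +-cancelʳ)
  open SetoidReasoning setoid
  open SemiringSolver commutativeSemiring using (solve; _:+_; _:*_; _:=_; con)

  Series : Set c
  Series = ℕ → Carrier

  infix 4 _≐_
  _≐_ : Series → Series → Set ℓ
  f ≐ g = ∀ a → f a ≈ g a

  one : Series
  one zero    = 1#
  one (suc _) = 0#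

  -- Multiplication by x^w. Recursion on both arguments gives zero below degree w without comparing
  -- a with w.
  shift : ℕ → Series → Series
  shift zero    f a       = f a
  shift (suc w) f zero    = 0#
  shift (suc w) f (suc a) = shift w f a

  -- Only coefficients of degree at most a - w enter. The bounded hypothesis is what lets
  -- `1+x^-cancel` use strong induction.
  shift-local : ∀ w {f g} a → (∀ b → b ℕ.+ w ℕ.≤ a → f b ≈ g b) → shift w f a ≈ shift w g a
  shift-local zero    a       f≈g = f≈g a (ℕₚ.≤-reflexive (ℕₚ.+-identityʳ a))
  shift-local (suc w) zero    f≈g = refl
  shift-local (suc w) (suc a) f≈g = shift-local w a λ b b+w≤a →
    f≈g b (ℕₚ.≤-trans (ℕₚ.≤-reflexive (ℕₚ.+-suc b w)) (s≤s b+w≤a))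

  shift-cong : ∀ w {f g} → f ≐ g → shift w f ≐ shift w g
  shift-cong w f≈g a = shift-local w a λ b _ → f≈g b

  shift-shift : ∀ v w f a → shift v (shift w f) a ≡ shift (v ℕ.+ w) f a
  shift-shift zero    w f a       = ≡.refl
  shift-shift (suc v) w f zero    = ≡.refl
  shift-shift (suc v) w f (suc a) = shift-shift v w f a

  shift-comm : ∀ v w f a → shift v (shift w f) a ≡ shift w (shift v f) a
  shift-comm v w f a = ≡.trans (shift-shift v w f a)
    (≡.trans (≡.cong (λ u → shift u f a) (ℕₚ.+-comm v w)) (≡.sym (shift-shift w v f a)))

  shift-+ : ∀ w f g a → shift w (λ b → f b + g b) a ≈ shift w f a + shift w g a
  shift-+ zero    f g a       = refl
  shift-+ (suc w) f g zero    = sym (+-identityˡ 0#)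
  shift-+ (suc w) f g (suc a) = shift-+ w f g a

  shift-∑ : ∀ w {n} (c : Fin n → Carrier) (f : Fin n → Series) a →
    shift w (λ b → ∑[ i < n ] (c i * f i b)) a ≈ ∑[ i < n ] (c i * shift w (f i) a)
  shift-∑ zero        c f a       = refl
  shift-∑ (suc w) {n} c f zero    =
    sym (trans (sum-cong-≋ (λ i → zeroʳ (c i))) (sum-replicate-zero n))
  shift-∑ (suc w)     c f (suc a) = shift-∑ w c f a

  -- Multiplication by 1 + x^w and its cancellation.

  1+x^_·_ : ℕ → Series → Series
  (1+x^ w · f) a = f a + shift w f a

  1+x^-cong : ∀ w {f g} → f ≐ g → 1+x^ w · f ≐ 1+x^ w · g
  1+x^-cong w f≈g a = +-cong (f≈g a) (shift-cong w f≈g a)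

  1+x^-comm : ∀ v w f → 1+x^ v · (1+x^ w · f) ≐ 1+x^ w · (1+x^ v · f)
  1+x^-comm v w f a = begin
    f a + shift w f a + shift v (1+x^ w · f) a
      ≈⟨ +-congˡ (shift-+ v f (shift w f) a) ⟩
    f a + shift w f a + (shift v f a + shift v (shift w f) a)
      ≈⟨ +-congˡ (+-congˡ (reflexive (shift-comm v w f a))) ⟩
    f a + shift w f a + (shift v f a + shift w (shift v f) a)
      ≈⟨ solve 4 (λ x y z t → x :+ y :+ (z :+ t) := x :+ z :+ (y :+ t)) refl _ _ _ _ ⟩
    f a + shift v f a + (shift w f a + shift w (shift v f) a)
      ≈⟨ +-congˡ (shift-+ w f (shift v f) a) ⟨
    f a + shift v f a + shift w (1+x^ v · f) a ∎

  -- Strong induction on the degree: since the exponent is positive, the shifted term at a involves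
  -- only coefficients below a, where f and g already agree, so it cancels.
  1+x^-cancel : ∀ w {f g} → 1+x^ suc w · f ≐ 1+x^ suc w · g → f ≐ g
  1+x^-cancel w {f} {g} eq = <-rec (λ a → f a ≈ g a) λ a f≈g →
    +-cancelʳ (shift (suc w) f a) (f a) (g a) (trans (eq a) (+-congˡ (sym
      (shift-local (suc w) a λ b b+1+w≤a → f≈g (ℕₚ.≤-trans
        (ℕₚ.≤-trans (ℕₚ.m≤m+n (suc b) w) (ℕₚ.≤-reflexive (≡.sym (ℕₚ.+-suc b w)))) b+1+w≤a)))))

  -- Alternating geometric sums.

  -1^ : ℕ → Carrier
  -1^ i = (- 1#) ^ i

  -1^[1+2k]≈-1 : ∀ k → -1^ (suc (k ℕ.* 2)) ≈ - 1#
  -1^[1+2k]≈-1 zero    = *-identityʳ (- 1#)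
  -1^[1+2k]≈-1 (suc k) = begin
    - 1# * (- 1# * -1^ (suc (k ℕ.* 2))) ≈⟨ *-congˡ (-1*x≈-x _) ⟩
    - 1# * - (-1^ (suc (k ℕ.* 2)))      ≈⟨ -1*x≈-x _ ⟩
    - - (-1^ (suc (k ℕ.* 2)))           ≈⟨ -‿involutive _ ⟩
    -1^ (suc (k ℕ.* 2))                 ≈⟨ -1^[1+2k]≈-1 k ⟩
    - 1#                                ∎

  -- Multiplication by ∑_{i<N} (-1)^i x^(iw).
  alt : ℕ → ℕ → Series → Series
  alt N w f a = ∑[ i < N ] (-1^ (toℕ i) * shift (toℕ i ℕ.* w) f a)

  -- All terms but the first share the factor -x^w. Letting x^w act on f allows an induction on N
  -- with f varying.
  alt-suc : ∀ N w f a → alt (suc N) w f a ≈ f a + - 1# * alt N w (shift w f) a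
  alt-suc N w f a = +-cong (*-identityˡ (f a)) (begin
    ∑[ i < N ] (- 1# * -1^ (toℕ i) * shift (w ℕ.+ toℕ i ℕ.* w) f a)
      ≈⟨ sum-cong-≋ {N} (λ i → trans (*-assoc _ _ _) (*-congˡ (*-congˡ (reflexive (≡.sym
           (≡.trans (shift-shift (toℕ i ℕ.* w) w f a)
             (≡.cong (λ u → shift u f a) (ℕₚ.+-comm (toℕ i ℕ.* w) w)))))))) ⟩
    ∑[ i < N ] (- 1# * (-1^ (toℕ i) * shift (toℕ i ℕ.* w) (shift w f) a))
      ≈⟨ *-distribˡ-sum {N} (- 1#) _ ⟨
    - 1# * alt N w (shift w f) a ∎)

  shift-alt : ∀ v N w f a →
    shift v (alt N w f) a ≈ ∑[ i < N ] (-1^ (toℕ i) * shift (v ℕ.+ toℕ i ℕ.* w) f a)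
  shift-alt v N w f a = trans
    (shift-∑ v {N} (λ i → -1^ (toℕ i)) (λ i → shift (toℕ i ℕ.* w) f) a)
    (sum-cong-≋ {N} λ i → *-congˡ (reflexive (shift-shift v (toℕ i ℕ.* w) f a)))

  shift-alt-comm : ∀ v N w f a → shift v (alt N w f) a ≈ alt N w (shift v f) a
  shift-alt-comm v N w f a = trans (shift-alt v N w f a)
    (sum-cong-≋ {N} λ i → *-congˡ (reflexive
      (≡.trans (≡.sym (shift-shift v (toℕ i ℕ.* w) f a)) (shift-comm v (toℕ i ℕ.* w) f a))))

  -- The geometric sum (1 + y) ∑_{i<N} (-y)^i = 1 - (-y)^N, without subtraction.
  alt-geometric : ∀ N w f a →
    alt N w f a + alt N w (shift w f) a + -1^ N * shift (N ℕ.* w) f a ≈ f a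
  alt-geometric zero    w f a = solve 1 (λ x → con 0 :+ con 0 :+ con 1 :* x := x) refl (f a)
  alt-geometric (suc N) w f a = begin
    alt (suc N) w f a + alt (suc N) w Ef a + - 1# * -1^ N * shift (w ℕ.+ N ℕ.* w) f a
      ≈⟨ +-cong (+-cong (alt-suc N w f a) (alt-suc N w Ef a)) (*-congˡ (reflexive
           (≡.trans (≡.cong (λ u → shift u f a) (ℕₚ.+-comm w (N ℕ.* w)))
             (≡.sym (shift-shift (N ℕ.* w) w f a))))) ⟩
    f a + - 1# * alt N w Ef a + (Ef a + - 1# * alt N w (shift w Ef) a)
      + - 1# * -1^ N * shift (N ℕ.* w) Ef a
      -- Regrouping isolates -1 times the left side of the identity for `Ef`; the induction
      -- hypothesis turns it into `- Ef`, which cancels.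
      ≈⟨ solve 7 (λ x y s p r t u → x :+ s :* p :+ (y :+ s :* r) :+ s :* t :* u
                    := x :+ (y :+ s :* (p :+ r :+ t :* u))) refl _ _ _ _ _ _ _ ⟩
    f a + (Ef a + - 1# * (alt N w Ef a + alt N w (shift w Ef) a + -1^ N * shift (N ℕ.* w) Ef a))
      ≈⟨ +-congˡ (+-congˡ (*-congˡ (alt-geometric N w Ef a))) ⟩
    f a + (Ef a + - 1# * Ef a) ≈⟨ +-congˡ (+-congˡ (-1*x≈-x (Ef a))) ⟩
    f a + (Ef a + - Ef a)      ≈⟨ +-congˡ (-‿inverseʳ (Ef a)) ⟩
    f a + 0#                   ≈⟨ +-identityʳ (f a) ⟩
    f a                        ∎
    where Ef = shift w f

  1+x^-alt : ∀ k w f (let N = suc (k ℕ.* 2)) → 1+x^ w · alt N w f ≐ 1+x^ (N ℕ.* w) · f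
  1+x^-alt k w f a = begin
    alt N w f a + shift w (alt N w f) a       ≈⟨ +-congˡ (shift-alt-comm w N w f a) ⟩
    S                                         ≈⟨ +-identityʳ S ⟨
    -- Zero is inserted as -t + t: for odd N, -t is the last term (-1)^N t of the geometric
    -- identity, so S - t collapses to f and t remains.
    S + 0#                                    ≈⟨ +-congˡ (-‿inverseˡ t) ⟨
    S + (- t + t)                             ≈⟨ +-assoc S (- t) t ⟨
    S + - t + t                               ≈⟨ +-congʳ (+-congˡ (-1*x≈-x t)) ⟨
    S + - 1# * t + t                          ≈⟨ +-congʳ (+-congˡ (*-congʳ (-1^[1+2k]≈-1 k))) ⟨
    S + -1^ N * t + t                         ≈⟨ +-congʳ (alt-geometric N w f a) ⟩
    f a + t                                   ∎
    where
    N = suc (k ℕ.* 2)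
    S = alt N w f a + alt N w (shift w f) a
    t = shift (N ℕ.* w) f a

  -- Products of three alternating sums.

  alt³ : (N₁ u N₂ v N₃ w : ℕ) → Series
  alt³ N₁ u N₂ v N₃ w = alt N₁ u (alt N₂ v (alt N₃ w one))

  -- The innermost factor 1 + x^u meets its alternating sum at once; each later factor is commuted
  -- inwards past the converted ones until it meets its own.
  1+x^-alt³ : ∀ k₁ u k₂ v k₃ w →
    (let N₁ = suc (k₁ ℕ.* 2); N₂ = suc (k₂ ℕ.* 2); N₃ = suc (k₃ ℕ.* 2)) →
    1+x^ w · (1+x^ v · (1+x^ u · alt³ N₁ u N₂ v N₃ w))
      ≐ 1+x^ (N₁ ℕ.* u) · (1+x^ (N₂ ℕ.* v) · (1+x^ (N₃ ℕ.* w) · one))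
  1+x^-alt³ k₁ u k₂ v k₃ w a = begin
    (1+x^ w · (1+x^ v · (1+x^ u · alt N₁ u Y))) a
      ≈⟨ 1+x^-cong w (1+x^-cong v (1+x^-alt k₁ u Y)) a ⟩
    (1+x^ w · (1+x^ v · (1+x^ (N₁ ℕ.* u) · Y))) a
      ≈⟨ 1+x^-cong w (1+x^-comm v (N₁ ℕ.* u) Y) a ⟩
    (1+x^ w · (1+x^ (N₁ ℕ.* u) · (1+x^ v · Y))) a
      ≈⟨ 1+x^-comm w (N₁ ℕ.* u) (1+x^ v · Y) a ⟩
    (1+x^ (N₁ ℕ.* u) · (1+x^ w · (1+x^ v · Y))) a
      ≈⟨ 1+x^-cong (N₁ ℕ.* u) (1+x^-cong w (1+x^-alt k₂ v Z)) a ⟩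
    (1+x^ (N₁ ℕ.* u) · (1+x^ w · (1+x^ (N₂ ℕ.* v) · Z))) a
      ≈⟨ 1+x^-cong (N₁ ℕ.* u) (1+x^-comm w (N₂ ℕ.* v) Z) a ⟩
    (1+x^ (N₁ ℕ.* u) · (1+x^ (N₂ ℕ.* v) · (1+x^ w · Z))) a
      ≈⟨ 1+x^-cong (N₁ ℕ.* u) (1+x^-cong (N₂ ℕ.* v) (1+x^-alt k₃ w one)) a ⟩
    (1+x^ (N₁ ℕ.* u) · (1+x^ (N₂ ℕ.* v) · (1+x^ (N₃ ℕ.* w) · one))) a ∎
    where
    N₁ = suc (k₁ ℕ.* 2)
    N₂ = suc (k₂ ℕ.* 2)
    N₃ = suc (k₃ ℕ.* 2)
    Z = alt N₃ w one
    Y = alt N₂ v Z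

  alt³-swap : ∀ k₁ k₂ k₃ →
    (let w₁ = suc (k₁ ℕ.* 2); w₂ = suc (k₂ ℕ.* 2); w₃ = suc (k₃ ℕ.* 2)) →
    alt³ w₁ w₃ w₂ w₁ w₃ w₂ ≐ alt³ w₁ w₂ w₃ w₁ w₂ w₃
  alt³-swap k₁ k₂ k₃ =
    -- The nesting, with w₂ outermost, is the order in which `1+x^-alt³` takes its factors for the
    -- left product.
    1+x^-cancel (k₃ ℕ.* 2) (1+x^-cancel (k₁ ℕ.* 2) (1+x^-cancel (k₂ ℕ.* 2) λ a → begin
      (1+x^ w₂ · (1+x^ w₁ · (1+x^ w₃ · alt³ w₁ w₃ w₂ w₁ w₃ w₂))) a
        ≈⟨ 1+x^-alt³ k₁ w₃ k₂ w₁ k₃ w₂ a ⟩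
      (1+x^ (w₁ ℕ.* w₃) · (1+x^ (w₂ ℕ.* w₁) · (1+x^ (w₃ ℕ.* w₂) · one))) a
        ≈⟨ 1+x^-comm (w₁ ℕ.* w₃) (w₂ ℕ.* w₁) _ a ⟩
      (1+x^ (w₂ ℕ.* w₁) · (1+x^ (w₁ ℕ.* w₃) · (1+x^ (w₃ ℕ.* w₂) · one))) a
        ≡⟨ ≡.cong₂ (λ x y → (1+x^ x · y) a) (ℕₚ.*-comm w₂ w₁)
             (≡.cong₂ (λ x y → 1+x^ x · (1+x^ y · one)) (ℕₚ.*-comm w₁ w₃) (ℕₚ.*-comm w₃ w₂)) ⟩
      (1+x^ (w₁ ℕ.* w₂) · (1+x^ (w₃ ℕ.* w₁) · (1+x^ (w₂ ℕ.* w₃) · one))) a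
        -- For the right product the factors arise in the order w₃, w₁, w₂; three transpositions
        -- restore the order used on the left.
        ≈⟨ 1+x^-alt³ k₁ w₂ k₃ w₁ k₂ w₃ a ⟨
      (1+x^ w₃ · (1+x^ w₁ · (1+x^ w₂ · g))) a
        ≈⟨ 1+x^-cong w₃ (1+x^-comm w₁ w₂ g) a ⟩
      (1+x^ w₃ · (1+x^ w₂ · (1+x^ w₁ · g))) a
        ≈⟨ 1+x^-comm w₃ w₂ (1+x^ w₁ · g) a ⟩
      (1+x^ w₂ · (1+x^ w₃ · (1+x^ w₁ · g))) a
        ≈⟨ 1+x^-cong w₂ (1+x^-comm w₃ w₁ g) a ⟩
      (1+x^ w₂ · (1+x^ w₁ · (1+x^ w₃ · g))) a ∎))
    where
    w₁ = suc (k₁ ℕ.* 2)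
    w₂ = suc (k₂ ℕ.* 2)
    w₃ = suc (k₃ ℕ.* 2)
    g = alt³ w₁ w₂ w₃ w₁ w₂ w₃

  -- Evaluation of polynomials by a linear functional.

  -- The functional x^a ↦ g(a), truncated to degrees below M.
  eval : ℕ → (ℕ → Carrier) → Series → Carrier
  eval M g f = ∑[ a < M ] (f (toℕ a) * g (toℕ a))

  eval-cong : ∀ M g {f f′} → f ≐ f′ → eval M g f ≈ eval M g f′
  eval-cong M g f≈f′ = sum-cong-≋ {M} λ a → *-congʳ (f≈f′ (toℕ a))

  eval-∑ : ∀ M g {n} (c : Fin n → Carrier) (f : Fin n → Series) →
    eval M g (λ a → ∑[ i < n ] (c i * f i a)) ≈ ∑[ i < n ] (c i * eval M g (f i))
  eval-∑ M g {n} c f = begin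
    ∑[ a < M ] (∑[ i < n ] (c i * f i (toℕ a)) * g (toℕ a))
      ≈⟨ sum-cong-≋ {M} (λ a → trans (*-distribʳ-sum {n} (g (toℕ a)) _)
           (sum-cong-≋ {n} λ i → *-assoc _ _ _)) ⟩
    ∑[ a < M ] ∑[ i < n ] (c i * (f i (toℕ a) * g (toℕ a)))
      ≈⟨ ∑-comm {M} {n} (λ a i → c i * (f i (toℕ a) * g (toℕ a))) ⟩
    ∑[ i < n ] ∑[ a < M ] (c i * (f i (toℕ a) * g (toℕ a)))
      ≈⟨ sum-cong-≋ {n} (λ i → *-distribˡ-sum {M} (c i) _) ⟨
    ∑[ i < n ] (c i * eval M g (f i)) ∎

  eval-x^ : ∀ M g b → b ℕ.< M → eval M g (shift b one) ≈ g b
  eval-x^ (suc M) g zero    _         = begin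
    1# * g 0 + ∑[ a < M ] (0# * g (suc (toℕ a)))
      ≈⟨ +-cong (*-identityˡ (g 0)) (trans
           (sum-cong-≋ {M} (λ a → zeroˡ (g (suc (toℕ a))))) (sum-replicate-zero M)) ⟩
    g 0 + 0# ≈⟨ +-identityʳ (g 0) ⟩
    g 0      ∎
  eval-x^ (suc M) g (suc b) (s≤s b<M) =
    trans (+-cong (zeroˡ (g 0)) (eval-x^ M (λ a → g (suc a)) b b<M)) (+-identityˡ _)

  -- The monomial x^v accumulates the exponents chosen from the factors expanded so far, starting at
  -- v = 0.
  eval-shift-alt : ∀ M g v N w f → eval M g (shift v (alt N w f))
    ≈ ∑[ i < N ] (-1^ (toℕ i) * eval M g (shift (v ℕ.+ toℕ i ℕ.* w) f))
  eval-shift-alt M g v N w f = trans (eval-cong M g (shift-alt v N w f))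
    (eval-∑ M g {N} (λ i → -1^ (toℕ i)) (λ i → shift (v ℕ.+ toℕ i ℕ.* w) f))

  eval-alt³ : ∀ M g N₁ u N₂ v N₃ w → N₁ ℕ.* u ℕ.+ N₂ ℕ.* v ℕ.+ N₃ ℕ.* w ℕ.< M →
    eval M g (alt³ N₁ u N₂ v N₃ w) ≈
      ∑[ i < N₁ ] (-1^ (toℕ i) * ∑[ j < N₂ ] (-1^ (toℕ j) * ∑[ h < N₃ ] (-1^ (toℕ h)
        * g (toℕ i ℕ.* u ℕ.+ toℕ j ℕ.* v ℕ.+ toℕ h ℕ.* w))))
  eval-alt³ M g N₁ u N₂ v N₃ w deg<M =
    trans (eval-shift-alt M g 0 N₁ u _) (sum-cong-≋ {N₁} λ i → *-congˡ (
      trans (eval-shift-alt M g (toℕ i ℕ.* u) N₂ v _) (sum-cong-≋ {N₂} λ j → *-congˡ (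
        trans (eval-shift-alt M g (toℕ i ℕ.* u ℕ.+ toℕ j ℕ.* v) N₃ w _) (sum-cong-≋ {N₃} λ h → *-congˡ (
          eval-x^ M g _ (ℕₚ.≤-<-trans
            -- The crude bounds i ≤ N₁, j ≤ N₂, h ≤ N₃ suffice, because M exceeds N₁u + N₂v + N₃w.
            (ℕₚ.+-mono-≤ (ℕₚ.+-mono-≤ (ℕₚ.*-monoˡ-≤ u (toℕ≤n i)) (ℕₚ.*-monoˡ-≤ v (toℕ≤n j)))
              (ℕₚ.*-monoˡ-≤ w (toℕ≤n h))) deg<M)))))))

-- Trinomial sums and the expansion of the power sums.

module PowerSumExpansion {c ℓ₁ ℓ₂ : Level} (K : ValuedField c ℓ₁ ℓ₂) where
  open ValuedField K
  open PowerSums K hiding (sum; _^_)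
  open Sum semiring
  open Exp commutativeSemiring
  open Mult semiring using (_×_; ×-congʳ; ×-assoc-*; ×1-homo-*; ×-homo-+)
  open SetoidReasoning setoid
  open SemiringSolver commutativeSemiring using (solve; _:*_; _:=_)
  open PowerSeries commutativeRing using (-1^)

  -- sum₃ kept folded, so that unification recovers the summand.
  opaque
    ∑₃ : ℕ → (ℕ → ℕ → ℕ → Carrier) → Carrier
    ∑₃ = sum₃

  opaque
    unfolding ∑₃

    ∑₃≡sum₃ : ∀ n f → ∑₃ n f ≡ sum₃ n f
    ∑₃≡sum₃ n f = ≡.refl

    ∑₃-cong : ∀ n {f g : ℕ → ℕ → ℕ → Carrier} → (∀ k l m → f k l m ≈ g k l m) →
      ∑₃ n f ≈ ∑₃ n g
    ∑₃-cong n f≈g = sum-cong-≋ {suc n} λ k → sum-cong-≋ {suc (n ∸ toℕ k)} λ l →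
      f≈g (toℕ k) (toℕ l) (n ∸ toℕ k ∸ toℕ l)

    *-distribˡ-∑₃ : ∀ n x (f : ℕ → ℕ → ℕ → Carrier) →
      x * ∑₃ n f ≈ ∑₃ n (λ k l m → x * f k l m)
    *-distribˡ-∑₃ n x f = trans
      (*-distribˡ-sum {suc n} x (λ k → ∑[ l < suc (n ∸ toℕ k) ] f (toℕ k) (toℕ l) (n ∸ toℕ k ∸ toℕ l)))
      (sum-cong-≋ {suc n} λ k → *-distribˡ-sum {suc (n ∸ toℕ k)} x
        (λ l → f (toℕ k) (toℕ l) (n ∸ toℕ k ∸ toℕ l)))

    ∑₃-∑-comm : ∀ n {N} (f : Fin N → ℕ → ℕ → ℕ → Carrier) →
      ∑₃ n (λ k l m → ∑[ i < N ] f i k l m) ≈ ∑[ i < N ] ∑₃ n (f i)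
    ∑₃-∑-comm n {N} f = trans
      (sum-cong-≋ {suc n} λ k → ∑-comm {suc (n ∸ toℕ k)} {N}
        (λ l i → f i (toℕ k) (toℕ l) (n ∸ toℕ k ∸ toℕ l)))
      (∑-comm {suc n} {N}
        (λ k i → ∑[ l < suc (n ∸ toℕ k) ] f i (toℕ k) (toℕ l) (n ∸ toℕ k ∸ toℕ l)))

  -- Draws one alternating sum out of the trinomial sum; `μ` carries the coefficient and all other
  -- factors, whether expanded or not.
  ∑₃-linear : ∀ n {N} (μ : ℕ → ℕ → ℕ → Carrier) (α : Fin N → Carrier)
    (f : Fin N → ℕ → ℕ → ℕ → Carrier) →
    ∑₃ n (λ k l m → μ k l m * ∑[ i < N ] (α i * f i k l m))
      ≈ ∑[ i < N ] (α i * ∑₃ n (λ k l m → μ k l m * f i k l m))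
  ∑₃-linear n {N} μ α f = begin
    ∑₃ n (λ k l m → μ k l m * ∑[ i < N ] (α i * f i k l m))
      ≈⟨ ∑₃-cong n (λ k l m → trans (*-distribˡ-sum {N} (μ k l m) _) (sum-cong-≋ {N} λ i →
           solve 3 (λ x y z → x :* (y :* z) := y :* (x :* z)) refl _ _ _)) ⟩
    ∑₃ n (λ k l m → ∑[ i < N ] (α i * (μ k l m * f i k l m)))
      ≈⟨ ∑₃-∑-comm n {N} (λ i k l m → α i * (μ k l m * f i k l m)) ⟩
    ∑[ i < N ] ∑₃ n (λ k l m → α i * (μ k l m * f i k l m))
      ≈⟨ sum-cong-≋ {N} (λ i → *-distribˡ-∑₃ n (α i) _) ⟨
    ∑[ i < N ] (α i * ∑₃ n (λ k l m → μ k l m * f i k l m)) ∎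

  fromℕ-* : ∀ m x → fromℕ m * x ≈ m × x
  fromℕ-* m x = trans (×-assoc-* m 1# x) (×-congʳ m (*-identityˡ x))

  -- The binomial theorem for x and y + z, then for y and z; the nested ranges of `sum₃` are exactly
  -- those of the two expansions.
  trinomial-theorem : ∀ n x y z →
    sum₃ n (λ k l m → fromℕ (multinomial n k l m) * (x ^ k * y ^ l * z ^ m)) ≈ (x + (y + z)) ^ n
  trinomial-theorem n x y z = sym (trans (Binomial.theorem commutativeSemiring n x (y + z))
    (sum-cong-≋ {suc n} λ k → let n∸k = n ∸ toℕ k; nCk = n C toℕ k in begin
      nCk × (x ^ toℕ k * (y + z) ^ n∸k)
        ≈⟨ fromℕ-* nCk _ ⟨
      fromℕ nCk * (x ^ toℕ k * (y + z) ^ n∸k)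
        ≈⟨ *-assoc _ _ _ ⟨
      fromℕ nCk * x ^ toℕ k * (y + z) ^ n∸k
        ≈⟨ *-congˡ (Binomial.theorem commutativeSemiring n∸k y z) ⟩
      fromℕ nCk * x ^ toℕ k * ∑[ l < suc n∸k ] ((n∸k C toℕ l) × (y ^ toℕ l * z ^ (n∸k ∸ toℕ l)))
        ≈⟨ *-distribˡ-sum {suc n∸k} _
             (λ l → (n∸k C toℕ l) × (y ^ toℕ l * z ^ (n∸k ∸ toℕ l))) ⟩
      ∑[ l < suc n∸k ]
        (fromℕ nCk * x ^ toℕ k * ((n∸k C toℕ l) × (y ^ toℕ l * z ^ (n∸k ∸ toℕ l))))
        ≈⟨ sum-cong-≋ {suc n∸k} (λ l → term k l) ⟩
      ∑[ l < suc n∸k ] (fromℕ (multinomial n (toℕ k) (toℕ l) (n∸k ∸ toℕ l))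
        * (x ^ toℕ k * y ^ toℕ l * z ^ (n∸k ∸ toℕ l))) ∎))
    where
    term : (k : Fin (suc n)) (l : Fin (suc (n ∸ toℕ k))) (let m = n ∸ toℕ k ∸ toℕ l) →
      fromℕ (n C toℕ k) * x ^ toℕ k * (((n ∸ toℕ k) C toℕ l) × (y ^ toℕ l * z ^ m))
        ≈ fromℕ (multinomial n (toℕ k) (toℕ l) m) * (x ^ toℕ k * y ^ toℕ l * z ^ m)
    term k l = begin
      fromℕ (n C toℕ k) * x ^ toℕ k * (((n ∸ toℕ k) C toℕ l) × (y ^ toℕ l * z ^ m))
        ≈⟨ *-congˡ (fromℕ-* ((n ∸ toℕ k) C toℕ l) _) ⟨
      fromℕ (n C toℕ k) * x ^ toℕ k * (fromℕ ((n ∸ toℕ k) C toℕ l) * (y ^ toℕ l * z ^ m))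
        ≈⟨ solve 5 (λ a b p r s → a :* p :* (b :* (r :* s)) := a :* b :* (p :* r :* s))
             refl _ _ _ _ _ ⟩
      fromℕ (n C toℕ k) * fromℕ ((n ∸ toℕ k) C toℕ l) * (x ^ toℕ k * y ^ toℕ l * z ^ m)
        ≈⟨ *-congʳ (×1-homo-* (n C toℕ k) ((n ∸ toℕ k) C toℕ l)) ⟨
      fromℕ ((n C toℕ k) ℕ.* ((n ∸ toℕ k) C toℕ l)) * (x ^ toℕ k * y ^ toℕ l * z ^ m)
        ≡⟨ ≡.cong (λ e → fromℕ e * (x ^ toℕ k * y ^ toℕ l * z ^ m))
             (multinomial≡C*C (toℕ≤pred[n] k) (toℕ≤pred[n] l)) ⟨
      fromℕ (multinomial n (toℕ k) (toℕ l) m) * (x ^ toℕ k * y ^ toℕ l * z ^ m) ∎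
      where m = n ∸ toℕ k ∸ toℕ l

  -- Formally the coefficient of t^k/k! in (q e^t)^a, which is why moments convolve as in
  -- `moment-+`.
  moment : ℕ → Carrier → ℕ → Carrier
  moment k q a = q ^ a * fromℕ a ^ k

  -- The value of x^a ↦ q^a a^k on the polynomial [N](x^w).
  altMoment : ℕ → Carrier → ℕ → ℕ → Carrier
  altMoment k q N w = ∑[ i < N ] (-1^ (toℕ i) * moment k q (toℕ i ℕ.* w))

  -- The power w^k merges with i^k into (iw)^k, and (q^w)^i is q^(iw). The bound becomes `suc N`
  -- because `T` includes its last index.
  T-scale : ∀ k q w N → T k (q ^ w) N * fromℕ w ^ k ≈ altMoment k q (suc N) w
  T-scale k q w N = trans (*-distribʳ-sum {suc N} (fromℕ w ^ k)
      (λ i → -1^ (toℕ i) * fromℕ (toℕ i) ^ k * (q ^ w) ^ toℕ i))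
    (sum-cong-≋ {suc N} λ i → begin
      -1^ (toℕ i) * fromℕ (toℕ i) ^ k * (q ^ w) ^ toℕ i * fromℕ w ^ k
        ≈⟨ solve 4 (λ s a r b → s :* a :* r :* b := s :* (r :* (a :* b))) refl _ _ _ _ ⟩
      -1^ (toℕ i) * ((q ^ w) ^ toℕ i * (fromℕ (toℕ i) ^ k * fromℕ w ^ k))
        ≈⟨ *-congˡ (*-cong (trans (^-assocʳ q w (toℕ i)) (^-congʳ q (ℕₚ.*-comm w (toℕ i))))
             (trans (sym (^-distrib-* (fromℕ (toℕ i)) (fromℕ w) k))
               (^-congˡ k (sym (×1-homo-* (toℕ i) w))))) ⟩
      -1^ (toℕ i) * moment k q (toℕ i ℕ.* w) ∎)

  -- The powers of q do not depend on k, l, m and multiply to q^(a+b+c); what remains is the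
  -- trinomial expansion of (a+b+c)^n.
  moment-+ : ∀ n q a b c →
    ∑₃ n (λ k l m → fromℕ (multinomial n k l m) * moment k q a * moment l q b * moment m q c)
      ≈ moment n q (a ℕ.+ b ℕ.+ c)
  moment-+ n q a b c = begin
    ∑₃ n (λ k l m → fromℕ (multinomial n k l m) * moment k q a * moment l q b * moment m q c)
      ≈⟨ ∑₃-cong n (λ k l m → solve 7 (λ μ p x r y s z →
           μ :* (p :* x) :* (r :* y) :* (s :* z) := p :* r :* s :* (μ :* (x :* y :* z)))
           refl _ _ _ _ _ _ _) ⟩
    ∑₃ n (λ k l m → q ^ a * q ^ b * q ^ c
      * (fromℕ (multinomial n k l m) * (fromℕ a ^ k * fromℕ b ^ l * fromℕ c ^ m)))
      ≈⟨ *-distribˡ-∑₃ n _ _ ⟨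
    q ^ a * q ^ b * q ^ c * ∑₃ n (λ k l m →
      fromℕ (multinomial n k l m) * (fromℕ a ^ k * fromℕ b ^ l * fromℕ c ^ m))
      ≈⟨ *-congˡ (trans (reflexive (∑₃≡sum₃ n _))
           (trinomial-theorem n (fromℕ a) (fromℕ b) (fromℕ c))) ⟩
    q ^ a * q ^ b * q ^ c * (fromℕ a + (fromℕ b + fromℕ c)) ^ n
      ≈⟨ *-cong (trans (^-homo-* q (a ℕ.+ b) c) (*-congʳ (^-homo-* q a b)))
           (^-congˡ n (trans (×-homo-+ 1# (a ℕ.+ b) c)
             (trans (+-congʳ (×-homo-+ 1# a b)) (+-assoc _ _ _)))) ⟨
    moment n q (a ℕ.+ b ℕ.+ c) ∎

  ∑₃-altMoment : ∀ n q N₁ u N₂ v N₃ w →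
    ∑₃ n (λ k l m → fromℕ (multinomial n k l m)
        * altMoment l q N₂ v * altMoment m q N₃ w * altMoment k q N₁ u)
      ≈ ∑[ i < N₁ ] (-1^ (toℕ i) * ∑[ j < N₂ ] (-1^ (toℕ j) * ∑[ h < N₃ ] (-1^ (toℕ h)
          * moment n q (toℕ i ℕ.* u ℕ.+ toℕ j ℕ.* v ℕ.+ toℕ h ℕ.* w))))
  ∑₃-altMoment n q N₁ u N₂ v N₃ w = trans
    (∑₃-linear n {N₁} _ _ (λ i k l m → moment k q (toℕ i ℕ.* u)))
    (sum-cong-≋ {N₁} λ i → *-congˡ (trans
      -- `∑₃-linear` expands the last factor only, so the sum indexed by l is moved there; below,
      -- the one indexed by m follows.
      (∑₃-cong n λ k l m → solve 4 (λ e b c x → e :* b :* c :* x := e :* x :* c :* b)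
        refl _ _ _ _)
      (trans (∑₃-linear n {N₂} _ _ (λ j k l m → moment l q (toℕ j ℕ.* v)))
        (sum-cong-≋ {N₂} λ j → *-congˡ (trans
          (∑₃-cong n λ k l m → solve 4 (λ e x c y → e :* x :* c :* y := e :* x :* y :* c)
            refl _ _ _ _)
          (trans (∑₃-linear n {N₃} _ _ (λ h k l m → moment m q (toℕ h ℕ.* w)))
            (sum-cong-≋ {N₃} λ h → *-congˡ
              (moment-+ n q (toℕ i ℕ.* u) (toℕ j ℕ.* v) (toℕ h ℕ.* w)))))))))

  sum₃-T-expand : ∀ n q N₁ u N₂ v N₃ w →
    sum₃ n (λ k l m → fromℕ (multinomial n k l m)
        * T k (q ^ u) N₁ * T l (q ^ v) N₂ * T m (q ^ w) N₃
        * fromℕ u ^ k * fromℕ v ^ l * fromℕ w ^ m)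
      ≈ ∑[ i < suc N₁ ] (-1^ (toℕ i) * ∑[ j < suc N₂ ] (-1^ (toℕ j)
          * ∑[ h < suc N₃ ] (-1^ (toℕ h)
          * moment n q (toℕ i ℕ.* u ℕ.+ toℕ j ℕ.* v ℕ.+ toℕ h ℕ.* w))))
  sum₃-T-expand n q N₁ u N₂ v N₃ w = trans (reflexive (≡.sym (∑₃≡sum₃ n _))) (trans
    (∑₃-cong n λ k l m → trans
      -- Each power is paired with the `T` of the same exponent for `T-scale`, and the k-pair is put
      -- last to be expanded first.
      (solve 7 (λ e a b c x y z →
          e :* a :* b :* c :* x :* y :* z := e :* (b :* y) :* (c :* z) :* (a :* x)) refl
        (fromℕ (multinomial n k l m)) (T k (q ^ u) N₁) (T l (q ^ v) N₂) (T m (q ^ w) N₃)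
        (fromℕ u ^ k) (fromℕ v ^ l) (fromℕ w ^ m))
      (*-cong (*-cong (*-congˡ (T-scale l q v N₂)) (T-scale m q w N₃)) (T-scale k q u N₁)))
    (∑₃-altMoment n q (suc N₁) u (suc N₂) v (suc N₃) w))

theorem4p17 : {c ℓ₁ ℓ₂ : Level} (p : ℕ) (p-prime : Prime p) → Odd p →
    (C : PadicComplexNumbers p c ℓ₁ ℓ₂) →
    let open ValuedField (PadicComplexNumbers.ℂₚ C)
        open PowerSums (PadicComplexNumbers.ℂₚ C)
    in
    (q : Carrier) → ∣ q - 1# ∣ <ᵐ convergenceRadius p-prime →
    (w₁ w₂ w₃ : ℕ) → Odd w₁ → Odd w₂ → Odd w₃ →
    (n : ℕ) →
    sum₃ n (λ k l m →
      fromℕ (multinomial n k l m)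
        * T k (q ^ w₃) (w₁ ∸ 1) * T l (q ^ w₁) (w₂ ∸ 1) * T m (q ^ w₂) (w₃ ∸ 1)
        * fromℕ w₃ ^ k * fromℕ w₁ ^ l * fromℕ w₂ ^ m)
    ≈
    sum₃ n (λ k l m →
      fromℕ (multinomial n k l m)
        * T k (q ^ w₂) (w₁ ∸ 1) * T l (q ^ w₁) (w₃ ∸ 1) * T m (q ^ w₃) (w₂ ∸ 1)
        * fromℕ w₂ ^ k * fromℕ w₁ ^ l * fromℕ w₃ ^ m)
theorem4p17 p _ _ C q _ w₁ w₂ w₃ odd₁ odd₂ odd₃ n
  with odd⇒1+2k odd₁ | odd⇒1+2k odd₂ | odd⇒1+2k odd₃
... | k₁ , ≡.refl | k₂ , ≡.refl | k₃ , ≡.refl =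
  trans (sum₃-T-expand n q (k₁ ℕ.* 2) w₃ (k₂ ℕ.* 2) w₁ (k₃ ℕ.* 2) w₂)
  (trans (sym (eval-alt³ M g w₁ w₃ w₂ w₁ w₃ w₂ (s≤s (ℕₚ.m≤m+n d₁ d₂))))
  -- Both triple sums are now values of one functional, and its two arguments are equal as series.
  (trans (eval-cong M g (alt³-swap k₁ k₂ k₃))
  (trans (eval-alt³ M g w₁ w₂ w₃ w₁ w₂ w₃ (s≤s (ℕₚ.m≤n+m d₂ d₁)))
    (sym (sum₃-T-expand n q (k₁ ℕ.* 2) w₂ (k₃ ℕ.* 2) w₁ (k₂ ℕ.* 2) w₃)))))
  where
  K = PadicComplexNumbers.ℂₚ C
  open ValuedField K using (commutativeRing; trans; sym)
  open PowerSeries commutativeRing using (eval-alt³; eval-cong; alt³-swap)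
  open PowerSumExpansion K using (sum₃-T-expand; moment)
  d₁ d₂ M : ℕ
  d₁ = w₁ ℕ.* w₃ ℕ.+ w₂ ℕ.* w₁ ℕ.+ w₃ ℕ.* w₂
  d₂ = w₁ ℕ.* w₂ ℕ.+ w₃ ℕ.* w₁ ℕ.+ w₂ ℕ.* w₃
  -- Above the degree bounds of both products, so that a single truncation serves both sides.
  M  = suc (d₁ ℕ.+ d₂)
  g = moment n q
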